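{- Let $H=\prod_p p^{a_p}<H'=\prod_p p^{b_p}$ be consecutive highly composite numbers. (i) If $L_-(H,H')=0$, then the transition consists of a single insertion (i.e. $H'=Hq$ for some prime $q$) and $\beta^{\mathrm{geo}}(H,H')=1$. (ii) If $L_-(H,H')=1$, let $p$ be the unique prime with $a_p>b_p$, and write $a:=a_p=b_p+1$. Then $$\beta^{\mathrm{geo}}(H,H')=\frac{a}{a+1}\ge\frac12.$$
   Context: $d(n)$ denotes the number of positive divisors of $n$. A positive integer $H$ is highly composite if $d(m)<d(H)$ for all integers $1\le m<H$. Two highly composite numbers $H<H'$ are consecutive if no highly composite number lies strictly between them. With $H=\prod_p p^{a_p}$, $H'=\prod_p p^{b_p}$, put $L_-(H,H')=\sum_p\max(a_p-b_p,0)$. An exponent-lattice geodesic from $H$ to $H'$ is a sequence of positive integers starting at $H$ and ending at $H'$ in which each step changes the exponent of exactly one prime by one unit, always in the direction of its target exponent; increasing steps are insertions, decreasing steps are deletions. It is $H'$-admissible if every vertex $z$ satisfies $z\le H'$. The normalised geodesic capacity is $$\beta^{\mathrm{geo}}(H,H')=\frac{1}{d(H)}\max_{\gamma}\min_{z\in\gamma}d(z),$$ where $\gamma$ ranges over the $H'$-admissible geodesics from $H$ to $H'$ and $z$ over all vertices of $\gamma$, endpoints included. -}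

module Defs where

open import Data.Integer.Base using (+_)
open import Data.List.Base using (List; filter; length; map; upTo)
open import Data.List.NonEmpty.Base as List⁺ using (List⁺; [_]; _∷⁺_; foldr₁)
open import Data.List.Properties using (filter-accept)
open import Data.List.Relation.Unary.All using (All)
open import Data.Nat.Base using (ℕ; zero; suc; _∸_; _⊓_; _⊔_; _≤_; _<_; NonZero)
open import Data.Nat.Divisibility using (_∣?_; 1∣_)
open import Data.Nat.ListAction using (sum)
open import Data.Nat.Primality using (Prime; prime?)
open import Data.Nat.Primality.Factorisation using (factors; factorise)
open import Data.Nat.Properties using (_≟_)
open import Data.Product.Base using (∃-syntax; _×_)
open import Data.Rational.Base using (ℚ; _/_)
open import Relation.Binary.Construct.Closure.ReflexiveTransitive using (Star; ε; _◅_)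
open import Relation.Binary.PropositionalEquality using (_≡_; _≢_; cong; sym; subst)
open import Relation.Nullary using (¬_)

divisors : ℕ → List ℕ
divisors n = filter (_∣? n) (map suc (upTo n))

d : ℕ → ℕ
d n = length (divisors n)

d-nonZero : ∀ n → .{{NonZero n}} → NonZero (d n)
d-nonZero (suc n) =
  subst NonZero (sym (cong length (filter-accept (_∣? suc n) (1∣ suc n)))) _

record HighlyComposite (n : ℕ) : Set where
  field
    positive : 1 ≤ n
    champion : ∀ m → 1 ≤ m → m < n → d m < d n

record ConsecutiveHC (H H′ : ℕ) : Set where
  field
    hc      : HighlyComposite H
    hc′     : HighlyComposite H′
    ordered : H < H′
    gap     : ∀ m → H < m → m < H′ → ¬ HighlyComposite m

-- Exponent of the prime p in n, i.e. its multiplicity in the prime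
-- factorisation of n; the value at n = 0 is junk.
ν : ℕ → ℕ → ℕ
ν p zero      = 0
ν p n@(suc _) = length (filter (p ≟_) (factors (factorise n)))

-- max(a - b, 0) is truncated subtraction.  Primes exceeding both numbers have
-- exponent 0 in each, so the sum over all primes may be cut off there.
L₋ : ℕ → ℕ → ℕ
L₋ H H′ = sum (map (λ p → ν p H ∸ ν p H′) (filter prime? (upTo (suc (H ⊔ H′)))))

SameExponentsExcept : ℕ → ℕ → ℕ → Set
SameExponentsExcept p z w = ∀ q → Prime q → q ≢ p → ν q w ≡ ν q z

data ExponentStep (T z w : ℕ) : Set where
  insertion : ∀ p → Prime p → ν p z < ν p T →
              ν p w ≡ suc (ν p z) → SameExponentsExcept p z w → ExponentStep T z w
  deletion  : ∀ p → Prime p → ν p T < ν p z →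
              suc (ν p w) ≡ ν p z → SameExponentsExcept p z w → ExponentStep T z w

-- One step towards the target T between positive integers.
record Step (T z w : ℕ) : Set where
  field
    source-positive : 1 ≤ z
    target-positive : 1 ≤ w
    exponentStep    : ExponentStep T z w

Geodesic : ℕ → ℕ → Set
Geodesic H H′ = Star (Step H′) H H′

vertices : ∀ {T z w} → Star (Step T) z w → List⁺ ℕ
vertices {z = z} ε       = [ z ]
vertices {z = z} (_ ◅ γ) = z ∷⁺ vertices γ

Admissible : ∀ {H H′} → Geodesic H H′ → Set
Admissible {H′ = H′} γ = All (_≤ H′) (List⁺.toList (vertices γ))

minDivisors : ∀ {H H′} → Geodesic H H′ → ℕ
minDivisors γ = foldr₁ _⊓_ (List⁺.map d (vertices γ))

-- m is the maximum (attained, and an upper bound) of min_{z ∈ γ} d(z) over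
-- the admissible geodesics γ from H to H′.
record IsMaxMin (H H′ m : ℕ) : Set where
  field
    attained : ∃[ γ ] Admissible {H} {H′} γ × minDivisors γ ≡ m
    maximal  : ∀ (γ : Geodesic H H′) → Admissible γ → minDivisors γ ≤ m

-- "β^geo(H,H′) = β".  The maximum is expressed as a relation; the value β is
-- determined by H and H′, and the relation includes existence of the maximum.
βᵍᵉᵒ[_,_]≡_ : (H H′ : ℕ) → .{{NonZero H}} → ℚ → Set
βᵍᵉᵒ[ H , H′ ]≡ β = ∃[ m ] IsMaxMin H H′ m × β ≡ ((+ m) / d H) {{d-nonZero H}}

{-# OPTIONS --safe #-}
-- No m < H′ has more divisors than H: the least m > H with d(m) > d(H) would be
-- a highly composite number between H and H′.  As d(nq) > d(n) for every prime q,
-- a proper multiple of H can only be H′ itself or exceed H′.  If L₋ = 0 then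
-- H ∣ H′, so H′ = Hq for any prime q dividing H′/H.  If L₋ = 1, an admissible
-- geodesic cannot start with an insertion (Hq ≠ H′, since the exponent of p still
-- has to drop), so its second vertex is H/p; conversely the geodesic
-- that deletes p first and then only inserts stays among the divisors of H′ and
-- has its minimum at H/p, where d(H/p) = d(H) · a/(a+1).
module Submission where

open import Defs
open import Data.Integer.Base as ℤ using (+_)
import Data.Integer.Properties as ℤ
open import Data.List.Base using (List; []; _∷_; _++_; filter; length; map; upTo)
open import Data.List.Membership.Propositional using (_∈_)
open import Data.List.Membership.Propositional.Properties using (∈-map⁺; ∈-map⁻; ∈-filter⁺; ∈-filter⁻; ∈-upTo⁺; ∈-++⁺ˡ; ∈-++⁺ʳ; ∈-++⁻)
open import Data.List.Membership.Propositional.Properties.WithK using (unique∧set⇒bag)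
open import Data.List.Properties using (length-++; length-map; filter-++; filter-accept; filter-reject)
open import Data.List.Relation.Binary.BagAndSetEquality using (∼bag⇒↭)
open import Data.List.Relation.Binary.Permutation.Propositional.Properties using (↭-length; filter-↭)
open import Data.List.Relation.Unary.All as All using (All; []; _∷_)
import Data.List.Relation.Unary.All.Properties as All
open import Data.List.Relation.Unary.Any using (here; there)
open import Data.List.Relation.Unary.Unique.Propositional using (Unique)
import Data.List.Relation.Unary.Unique.Propositional.Properties as Unique
open import Data.Nat.Base using (ℕ; zero; suc; _+_; _*_; _∸_; _^_; _⊓_; _⊔_; _≤_; _<_; z≤n; s≤s; NonZero; >-nonZero; >-nonZero⁻¹; ≢-nonZero; ≢-nonZero⁻¹)
open import Data.Nat.Divisibility
open import Data.Nat.Induction using (<-rec)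
open import Data.Nat.ListAction using (sum; product)
open import Data.Nat.ListAction.Properties using (product-++; ∈⇒∣product)
open import Data.Nat.Primality using (Prime; prime?; euclidsLemma; prime⇒nonZero; productOfPrimes≢0)
open import Data.Nat.Primality.Factorisation using (PrimeFactorisation; factors; factorise; factorisationUnique; primeFactorisation[p])
open import Data.Nat.Properties
open import Data.Product.Base using (∃-syntax; _×_; _,_; proj₁; proj₂)
open import Data.Rational.Base using (1ℚ; ½; _/_; _≥_)
import Data.Rational.Properties as ℚ
open import Data.Rational.Unnormalised.Base using (mkℚᵘ; *≤*; *≡*)
import Data.Rational.Unnormalised.Properties as ℚᵘ
open import Data.Sum.Base using (_⊎_; inj₁; inj₂)
open import Function.Base using (_∘_)
open import Function.Bundles using (mk⇔)
open import Relation.Binary.Construct.Closure.ReflexiveTransitive using (Star; ε; _◅_)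
open import Relation.Binary.PropositionalEquality using (_≡_; _≢_; refl; sym; trans; cong; cong₂; subst; subst₂; module ≡-Reasoning)
open import Relation.Nullary using (¬_; yes; no; contradiction)

open PrimeFactorisation using (isFactorisation; factorsPrime)

private
  variable
    m n p q T z w : ℕ

-- Sums of natural numbers equal to 0 or 1

sum≡0⇒0 : ∀ (f : ℕ → ℕ) xs → sum (map f xs) ≡ 0 → ∀ {x} → x ∈ xs → f x ≡ 0
sum≡0⇒0 f (x ∷ xs) eq (here refl)  = m+n≡0⇒m≡0 (f x) eq
sum≡0⇒0 f (x ∷ xs) eq (there x∈xs) = sum≡0⇒0 f xs (m+n≡0⇒n≡0 (f x) eq) x∈xs

-- A head of value 0 passes the search on to the tail, and a head of value 1 leaves a tail of sum 0.
-- This singles out the one prime whose exponent drops when `L₋` is 1.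
sum≡1⇒unique : ∀ (f : ℕ → ℕ) xs → sum (map f xs) ≡ 1 →
               ∃[ x ] x ∈ xs × f x ≡ 1 × (∀ {y} → y ∈ xs → f y ≢ 0 → y ≡ x)
sum≡1⇒unique f (x ∷ xs) eq with f x in fx
... | zero with y , y∈xs , fy≡1 , unique ← sum≡1⇒unique f xs eq =
  y , there y∈xs , fy≡1 , λ where
    (here refl)  fx≢0 → contradiction fx fx≢0
    (there z∈xs) fz≢0 → unique z∈xs fz≢0
... | suc zero = x , here refl , fx , λ where
    (here refl)  _    → refl
    (there z∈xs) fz≢0 → contradiction (sum≡0⇒0 f xs (suc-injective eq) z∈xs) fz≢0

-- Exponents

-- Prime factorisations agree up to permutation, so the exponent may be counted in whichever one is
-- convenient instead of the one returned by `factorise`.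
ν-factors : ∀ p .{{_ : NonZero n}} (f : PrimeFactorisation n) →
            ν p n ≡ length (filter (p ≟_) (factors f))
ν-factors {suc n} p f = ↭-length (filter-↭ (p ≟_) (factorisationUnique (factorise (suc n)) f))

ν-* : ∀ p m n .{{_ : NonZero m}} .{{_ : NonZero n}} → ν p (m * n) ≡ ν p m + ν p n
ν-* p m n = begin
  ν p (m * n)                                            ≡⟨ ν-factors p {{m*n≢0 m n}} mn ⟩
  length (filter (p ≟_) (fs ++ gs))                      ≡⟨ cong length (filter-++ (p ≟_) fs gs) ⟩
  length (filter (p ≟_) fs ++ filter (p ≟_) gs)          ≡⟨ length-++ (filter (p ≟_) fs) ⟩
  length (filter (p ≟_) fs) + length (filter (p ≟_) gs)  ≡⟨ cong₂ _+_ (ν-factors p (factorise m)) (ν-factors p (factorise n)) ⟨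
  ν p m + ν p n                                          ∎
  where
  open ≡-Reasoning
  fs = factors (factorise m)
  gs = factors (factorise n)
  -- Concatenating the two factor lists factorises the product, which makes the counts add.
  mn : PrimeFactorisation (m * n)
  mn = record
    { factors         = fs ++ gs
    ; isFactorisation = trans (cong₂ _*_ (isFactorisation (factorise m)) (isFactorisation (factorise n)))
                              (sym (product-++ fs gs))
    ; factorsPrime    = All.++⁺ (factorsPrime (factorise m)) (factorsPrime (factorise n))
    }

ν-self : Prime p → ν p p ≡ 1
ν-self {p} pp = trans (ν-factors p {{prime⇒nonZero pp}} (primeFactorisation[p] pp))
                      (cong length (filter-accept (p ≟_) {xs = []} refl))

ν-other : Prime p → q ≢ p → ν q p ≡ 0
ν-other {p} {q} pp q≢p = trans (ν-factors q {{prime⇒nonZero pp}} (primeFactorisation[p] pp))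
                               (cong length (filter-reject (q ≟_) {xs = []} q≢p))

ν-*-self : ∀ n .{{_ : NonZero n}} → Prime p → ν p (n * p) ≡ suc (ν p n)
ν-*-self {p} n pp = trans (ν-* p n p)
                          (trans (cong (_+_ (ν p n)) (ν-self pp)) (+-comm (ν p n) 1))
  where instance _ = prime⇒nonZero pp

ν-*-other : ∀ n .{{_ : NonZero n}} → Prime p → q ≢ p → ν q (n * p) ≡ ν q n
ν-*-other {p} {q} n pp q≢p = trans (ν-* q n p)
                                   (trans (cong (_+_ (ν q n)) (ν-other pp q≢p)) (+-identityʳ (ν q n)))
  where instance _ = prime⇒nonZero pp

-- A nonzero count means that `p` itself occurs in the factor list, and every entry divides the
-- product.
ν≢0⇒∣ : ∀ p n → ν p n ≢ 0 → p ∣ n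
ν≢0⇒∣ p zero    ν≢0 = p ∣0
ν≢0⇒∣ p (suc n) ν≢0 with filter (p ≟_) fs | (λ {x} → ∈-filter⁻ (p ≟_) {v = x} {xs = fs})
  where fs = factors (factorise (suc n))
... | []     | _ = contradiction refl ν≢0
... | x ∷ _  | ∈⇒ with x∈fs , refl ← ∈⇒ (here refl) =
  subst (x ∣_) (sym (isFactorisation (factorise (suc n)))) (∈⇒∣product x∈fs)

∣⇒nonZero : .{{NonZero n}} → m ∣ n → NonZero m
∣⇒nonZero {n} {zero}  0∣n = contradiction (0∣⇒≡0 0∣n) (≢-nonZero⁻¹ n)
∣⇒nonZero {n} {suc m} _   = _

ν-mono-∣ : ∀ p .{{_ : NonZero n}} → m ∣ n → ν p m ≤ ν p n
ν-mono-∣ {n} {m} p m∣n@(divides k refl) =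
  subst (ν p m ≤_) (sym (ν-* p k m {{∣⇒nonZero (divides m (*-comm k m))}} {{∣⇒nonZero m∣n}})) (m≤n+m (ν p m) (ν p k))

∣⇒ν>0 : .{{_ : NonZero n}} → Prime p → p ∣ n → 0 < ν p n
∣⇒ν>0 {n} {p} pp p∣n = subst (_≤ ν p n) (ν-self pp) (ν-mono-∣ p p∣n)

-- Induction on the list: the head `p` has positive exponent in the product, hence in `w`, so it
-- divides `w`. Cancelling it on both sides lowers the same exponents and preserves the
-- inequalities.
ν-≤-product⇒∣ : ∀ {ps} → All Prime ps → ∀ w .{{_ : NonZero w}} →
                (∀ q → Prime q → ν q (product ps) ≤ ν q w) → product ps ∣ w
ν-≤-product⇒∣ []                       w ν≤ = 1∣ w
ν-≤-product⇒∣ {p ∷ ps} (pp ∷ primes) w ν≤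
  with ν≢0⇒∣ p w (m<n⇒n≢0 (≤-trans (∣⇒ν>0 {{productOfPrimes≢0 (pp ∷ primes)}} pp (m∣m*n (product ps))) (ν≤ p pp)))
... | divides k refl = subst (p * product ps ∣_) (*-comm p k) (*-monoʳ-∣ p (ν-≤-product⇒∣ primes k ν≤′))
  where
  instance
    _ = productOfPrimes≢0 primes
    _ = ∣⇒nonZero {k * p} (m∣m*n {k} p)
    _ = prime⇒nonZero pp
  ν≤′ : ∀ q → Prime q → ν q (product ps) ≤ ν q k
  ν≤′ q pq = +-cancelˡ-≤ (ν q p) _ _
    (subst₂ _≤_ (ν-* q p (product ps)) (trans (ν-* q k p) (+-comm (ν q k) (ν q p))) (ν≤ q pq))

ν-≤⇒∣ : ∀ z w .{{_ : NonZero z}} .{{_ : NonZero w}} → (∀ q → Prime q → ν q z ≤ ν q w) → z ∣ w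
ν-≤⇒∣ z w ν≤ = subst (_∣ w) (sym z≡) (ν-≤-product⇒∣ (factorsPrime (factorise z)) w
    λ q pq → subst (λ n → ν q n ≤ ν q w) z≡ (ν≤ q pq))
  where z≡ = isFactorisation (factorise z)

ν-injective : ∀ z w .{{_ : NonZero z}} .{{_ : NonZero w}} → (∀ q → Prime q → ν q z ≡ ν q w) → z ≡ w
ν-injective z w ν≡ = ∣-antisym (ν-≤⇒∣ z w λ q pq → ≤-reflexive (ν≡ q pq))
                               (ν-≤⇒∣ w z λ q pq → ≤-reflexive (sym (ν≡ q pq)))

*-prime-unique : ∀ z w .{{_ : NonZero z}} .{{_ : NonZero w}} → Prime p →
                 ν p w ≡ suc (ν p z) → SameExponentsExcept p z w → w ≡ z * p
*-prime-unique {p} z w pp νp same = ν-injective w (z * p) eq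
  where
  instance
    _ = prime⇒nonZero pp
    _ = m*n≢0 z p
  eq : ∀ q → Prime q → ν q w ≡ ν q (z * p)
  eq q pq with q ≟ p
  ... | yes refl = trans νp (sym (ν-*-self z pp))
  ... | no  q≢p  = trans (same q pq q≢p) (sym (ν-*-other z pp q≢p))

-- One factor `p` is divided out per unit of exponent; once the exponent is 0, `p` cannot divide the
-- rest.
prime-split : ∀ n .{{_ : NonZero n}} → Prime p → ∃[ m ] NonZero m × ¬ p ∣ m × n ≡ p ^ ν p n * m
prime-split {p} n pp = go (ν p n) n refl
  where
  instance _ = prime⇒nonZero pp
  go : ∀ a n .{{_ : NonZero n}} → ν p n ≡ a → ∃[ m ] NonZero m × ¬ p ∣ m × n ≡ p ^ a * m
  go zero n νn = n , ≢-nonZero (≢-nonZero⁻¹ n) , p∤n , sym (*-identityˡ n)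
    where
    p∤n : ¬ p ∣ n
    p∤n p∣n = m<n⇒n≢0 (∣⇒ν>0 pp p∣n) νn
  go (suc a) n νn with ν≢0⇒∣ p n (λ ν≡0 → contradiction (trans (sym ν≡0) νn) λ ())
  ... | divides k refl =
    let instance _ = ∣⇒nonZero {k * p} (m∣m*n {k} p)
        m , m≢0 , p∤m , k≡ = go a k (suc-injective (trans (sym (ν-*-self k pp)) νn))
    in m , m≢0 , p∤m , trans (*-comm k p) (trans (cong (p *_) k≡) (sym (*-assoc p (p ^ a) m)))

-- Counting divisors

∈-divisors⁺ : .{{_ : NonZero n}} → m ∣ n → m ∈ divisors n
∈-divisors⁺ {n} {zero}  0∣n = contradiction (0∣⇒≡0 0∣n) (≢-nonZero⁻¹ n)
∈-divisors⁺ {n} {suc m} m∣n = ∈-filter⁺ (_∣? n) (∈-map⁺ suc (∈-upTo⁺ (∣⇒≤ m∣n))) m∣n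

∈-divisors⁻ : ∀ n → m ∈ divisors n → m ∣ n
∈-divisors⁻ n = proj₂ ∘ ∈-filter⁻ (_∣? n) {xs = map suc (upTo n)}

divisors-unique : ∀ n → Unique (divisors n)
divisors-unique n = Unique.filter⁺ (_∣? n) (Unique.map⁺ suc-injective (Unique.upTo⁺ n))

-- In `p * n ≡ k * e` Euclid's lemma places `p` in `k` or in `e`; cancelling it there gives the two
-- alternatives.
∣prime*⁻ : ∀ {e} n → Prime p → e ∣ p * n → e ∣ n ⊎ (∃[ f ] f ∣ n × e ≡ p * f)
∣prime*⁻ {p} {e} n pp (divides k pn≡ke) with euclidsLemma k e pp (subst (p ∣_) pn≡ke (m∣m*n n))
... | inj₁ (divides k′ refl) = inj₁ (divides k′ (*-cancelˡ-≡ n (k′ * e) p {{prime⇒nonZero pp}}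
        (trans pn≡ke (trans (cong (_* e) (*-comm k′ p)) (*-assoc p k′ e)))))
... | inj₂ (divides f refl)  = inj₂ (f , divides k (*-cancelˡ-≡ n (k * f) p {{prime⇒nonZero pp}}
        (trans pn≡ke (trans (sym (*-assoc k f p)) (*-comm (k * f) p)))) , *-comm f p)

-- Iterates the previous split: a divisor either spares one factor `p` or absorbs the whole power.
∣prime^*⁻ : ∀ {e} a m → Prime p → e ∣ p ^ suc a * m →
            e ∣ p ^ a * m ⊎ (∃[ f ] f ∣ m × e ≡ p ^ suc a * f)
∣prime^*⁻ {p} {e} a m pp e∣ with ∣prime*⁻ (p ^ a * m) pp (subst (e ∣_) (*-assoc p (p ^ a) m) e∣)
... | inj₁ e∣′ = inj₁ e∣′
∣prime^*⁻ {p} zero m pp e∣ | inj₂ (f , f∣ , refl) =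
  inj₂ (f , subst (f ∣_) (*-identityˡ m) f∣ , cong (_* f) (sym (*-identityʳ p)))
∣prime^*⁻ {p} (suc a) m pp e∣ | inj₂ (f , f∣ , refl) with ∣prime^*⁻ a m pp f∣
... | inj₁ f∣′             = inj₁ (subst (p * f ∣_) (sym (*-assoc p (p ^ a) m)) (*-monoʳ-∣ p f∣′))
... | inj₂ (g , g∣m , refl) = inj₂ (g , g∣m , sym (*-assoc p (p ^ suc a) g))

-- The divisors are those of `p ^ a * m` together with `p ^ suc a` times those of `m`. Both lists
-- are free of duplicates and have the same members, so they are permutations of each other.
d-prime^suc : ∀ a m .{{_ : NonZero m}} → Prime p → ¬ p ∣ m → d (p ^ suc a * m) ≡ d (p ^ a * m) + d m
d-prime^suc {p} a m pp p∤m = begin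
  d (p ^ suc a * m)                                ≡⟨ ↭-length {xs = divisors (p ^ suc a * m)} (∼bag⇒↭ (unique∧set⇒bag (divisors-unique (p ^ suc a * m)) ++-unique (mk⇔ to from))) ⟩
  length (divisors (p ^ a * m) ++ multiples)       ≡⟨ length-++ (divisors (p ^ a * m)) ⟩
  d (p ^ a * m) + length multiples                 ≡⟨ cong (_+_ (d (p ^ a * m))) (length-map (p ^ suc a *_) (divisors m)) ⟩
  d (p ^ a * m) + d m                              ∎
  where
  open ≡-Reasoning
  instance
    _ = prime⇒nonZero pp
    _ = m^n≢0 p a
    _ = m^n≢0 p (suc a)
    _ = m*n≢0 (p ^ a) m
    _ = m*n≢0 (p ^ suc a) m
  multiples : List ℕ
  multiples = map (p ^ suc a *_) (divisors m)

  ++-unique : Unique (divisors (p ^ a * m) ++ multiples)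
  ++-unique = Unique.++⁺ {xs = divisors (p ^ a * m)} (divisors-unique (p ^ a * m))
    (Unique.map⁺ (λ {x} {y} → *-cancelˡ-≡ x y (p ^ suc a)) (divisors-unique m))
    λ (e∈ , e∈′) → not-multiple (∈-divisors⁻ (p ^ a * m) e∈) (∈-map⁻ (p ^ suc a *_) e∈′)
    where
    not-multiple : ∀ {e} → e ∣ p ^ a * m → ¬ (∃[ f ] f ∈ divisors m × e ≡ p ^ suc a * f)
    -- Cancelling `p ^ a` leaves `p * f ∣ m`, which the coprimality of `p` and `m` forbids.
    not-multiple e∣ (f , _ , refl) = p∤m (m*n∣⇒m∣ p f (*-cancelˡ-∣ (p ^ a)
      (subst (_∣ p ^ a * m) (trans (cong (_* f) (*-comm p (p ^ a))) (*-assoc (p ^ a) p f)) e∣)))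

  to : ∀ {e} → e ∈ divisors (p ^ suc a * m) → e ∈ divisors (p ^ a * m) ++ multiples
  to e∈ with ∣prime^*⁻ a m pp (∈-divisors⁻ (p ^ suc a * m) e∈)
  ... | inj₁ e∣              = ∈-++⁺ˡ (∈-divisors⁺ e∣)
  ... | inj₂ (f , f∣m , refl) = ∈-++⁺ʳ (divisors (p ^ a * m)) (∈-map⁺ (p ^ suc a *_) (∈-divisors⁺ f∣m))

  from : ∀ {e} → e ∈ divisors (p ^ a * m) ++ multiples → e ∈ divisors (p ^ suc a * m)
  from e∈ with ∈-++⁻ (divisors (p ^ a * m)) e∈
  ... | inj₁ e∈ˡ = ∈-divisors⁺ (∣-trans (∈-divisors⁻ (p ^ a * m) e∈ˡ) (*-monoˡ-∣ m (n∣m*n p)))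
  ... | inj₂ e∈ʳ with f , f∈ , refl ← ∈-map⁻ (p ^ suc a *_) e∈ʳ =
    ∈-divisors⁺ (*-monoʳ-∣ (p ^ suc a) (∈-divisors⁻ m f∈))

d-prime^ : ∀ a m .{{_ : NonZero m}} → Prime p → ¬ p ∣ m → d (p ^ a * m) ≡ suc a * d m
d-prime^ zero    m pp p∤m = trans (cong d (*-identityˡ m)) (sym (*-identityˡ (d m)))
d-prime^ (suc a) m pp p∤m = trans (d-prime^suc a m pp p∤m)
  (trans (cong (_+ d m) (d-prime^ a m pp p∤m)) (+-comm (suc a * d m) (d m)))

-- The common factor `c` is the divisor count of the part of `n` prime to `p`. It serves both the
-- growth of `d` under insertion and the exact ratio of the two counts.
d-*-prime : ∀ n .{{_ : NonZero n}} → Prime p →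
            ∃[ c ] NonZero c × d n ≡ suc (ν p n) * c × d (n * p) ≡ suc (suc (ν p n)) * c
d-*-prime {p} n pp with m , m≢0 , p∤m , n≡ ← prime-split n pp =
  d m , d-nonZero m , trans (cong d n≡) (d-prime^ a m pp p∤m) ,
  trans (cong d (trans (*-comm n p) (trans (cong (p *_) n≡) (sym (*-assoc p (p ^ a) m)))))
        (d-prime^ (suc a) m pp p∤m)
  where
  a = ν p n
  instance _ = m≢0

d-<-*-prime : ∀ n .{{_ : NonZero n}} → Prime p → d n < d (n * p)
d-<-*-prime {p} n pp with c , c≢0 , dn≡ , dnp≡ ← d-*-prime n pp =
  subst₂ _<_ (sym dn≡) (sym dnp≡) (*-monoˡ-< c {{c≢0}} (n<1+n (suc (ν p n))))

-- Geodesics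

minDivisors≤source : (γ : Geodesic z T) → minDivisors γ ≤ d z
minDivisors≤source         ε       = ≤-refl
minDivisors≤source {z = z} (s ◅ γ) = m⊓n≤m (d z) (minDivisors γ)

source-admissible : (γ : Geodesic z T) → Admissible γ → z ≤ T
source-admissible ε       (z≤ ∷ _) = z≤
source-admissible (_ ◅ _) (z≤ ∷ _) = z≤

insert : ∀ z .{{_ : NonZero z}} → .{{NonZero T}} → Prime q → z * q ∣ T → Step T z (z * q)
insert {T} {q} z pq zq∣T = record
  { source-positive = >-nonZero⁻¹ z
  ; target-positive = >-nonZero⁻¹ (z * q) {{∣⇒nonZero zq∣T}}
  ; exponentStep    = insertion q pq (subst (_≤ ν q T) (ν-*-self z pq) (ν-mono-∣ q zq∣T))
                        (ν-*-self z pq) (λ _ _ r≢q → ν-*-other z pq r≢q)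
  }

-- The primes of the list are inserted one at a time. Every vertex divides `T`, hence is at most
-- `T`, and `d` grows at each step, so the minimum sits at the start.
ascend-product : ∀ {ps} → All Prime ps → ∀ z .{{_ : NonZero z}} → T ≡ z * product ps →
         ∃[ γ ] Admissible {z} {T} γ × minDivisors γ ≡ d z
ascend-product {T} [] z T≡ with refl ← trans T≡ (*-identityʳ z) = ε , ≤-refl ∷ [] , refl
ascend-product {T} {p ∷ ps} (pp ∷ primes) z T≡ =
  let γ , adm , min≡ = ascend-product primes (z * p) T≡′
      s              = insert z pp (divides (product ps) (trans T≡′ (*-comm (z * p) (product ps))))
  in s ◅ γ , ∣⇒≤ (divides (p * product ps) (trans T≡ (*-comm z (p * product ps)))) ∷ adm ,
     trans (cong (d z ⊓_) min≡) (m≤n⇒m⊓n≡m (<⇒≤ (d-<-*-prime z pp)))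
  where
  T≡′ : T ≡ z * p * product ps
  T≡′ = trans T≡ (sym (*-assoc z p (product ps)))
  instance
    _ = prime⇒nonZero pp
    _ = productOfPrimes≢0 primes
    _ = m*n≢0 z p
    T≢0 : NonZero T
    T≢0 = subst NonZero (sym T≡′) (m*n≢0 (z * p) (product ps))

ascend : ∀ z T .{{_ : NonZero T}} → z ∣ T → ∃[ γ ] Admissible {z} {T} γ × minDivisors γ ≡ d z
ascend z T z∣T@(divides k T≡kz) = ascend-product (factorsPrime (factorise k)) z
  (trans T≡kz (trans (*-comm k z) (cong (z *_) (isFactorisation (factorise k)))))
  where
  instance
    _ = ∣⇒nonZero z∣T
    k≢0 : NonZero k
    k≢0 = ∣⇒nonZero (divides z (trans T≡kz (*-comm k z)))

-- Consecutive highly composite numbers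

module _ {H H′ : ℕ} (consecutive : ConsecutiveHC H H′) where

  open ConsecutiveHC consecutive

  private instance
    H≢0 : NonZero H
    H≢0 = >-nonZero (HighlyComposite.positive hc)
    H′≢0 : NonZero H′
    H′≢0 = >-nonZero (HighlyComposite.positive hc′)

  d≤d[H] : ∀ m → 1 ≤ m → m < H′ → d m ≤ d H
  -- By the induction hypothesis, an `m` with `d H < d m` beats all smaller numbers and is therefore
  -- highly composite. It exceeds `H` by `d≤-below`, which contradicts `gap`.
  d≤d[H] = <-rec _ λ m rec 1≤m m<H′ → ≮⇒≥ λ dH<dm →
    gap m (≰⇒> λ m≤H → <⇒≱ dH<dm (d≤-below m 1≤m m≤H)) m<H′ (record
      { positive = 1≤m
      ; champion = λ k 1≤k k<m → ≤-<-trans (rec k<m 1≤k (<-trans k<m m<H′)) dH<dm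
      })
    where
    d≤-below : ∀ m → 1 ≤ m → m ≤ H → d m ≤ d H
    d≤-below m 1≤m m≤H with m≤n⇒m<n∨m≡n m≤H
    ... | inj₁ m<H  = <⇒≤ (HighlyComposite.champion hc m 1≤m m<H)
    ... | inj₂ refl = ≤-refl

  H*prime≡H′ : Prime q → H * q ≤ H′ → H * q ≡ H′
  H*prime≡H′ {q} pq Hq≤H′ with m≤n⇒m<n∨m≡n Hq≤H′
  ... | inj₂ Hq≡H′ = Hq≡H′
  ... | inj₁ Hq<H′ = contradiction
    (d≤d[H] (H * q) (>-nonZero⁻¹ (H * q)) Hq<H′)
    (<⇒≱ (d-<-*-prime H pq))
    where
    instance
      _ = prime⇒nonZero pq
      _ = m*n≢0 H q

  excess : ℕ → ℕ
  excess p = ν p H ∸ ν p H′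

  primes : List ℕ
  primes = filter prime? (upTo (suc (H ⊔ H′)))

  -- The cut-off in `L₋` loses nothing: a prime whose exponent drops has positive exponent in `H`,
  -- so it divides `H` and is at most `H`.
  excess∈primes : Prime q → ν q H′ < ν q H → q ∈ primes
  excess∈primes {q} pq ν< = ∈-filter⁺ prime? (∈-upTo⁺ (s≤s (≤-trans
    (∣⇒≤ (ν≢0⇒∣ q H λ ν≡0 → n≮0 (subst (ν q H′ <_) ν≡0 ν<))) (m≤m⊔n H H′)))) pq

  -- Transitions without deletions

  L₋≡0⇒H∣H′ : L₋ H H′ ≡ 0 → H ∣ H′
  L₋≡0⇒H∣H′ L₋≡0 = ν-≤⇒∣ H H′ λ q pq → ≮⇒≥ λ ν< →
    contradiction (sum≡0⇒0 excess primes L₋≡0 (excess∈primes pq ν<)) (m>n⇒m∸n≢0 ν<)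

  single-insertion : L₋ H H′ ≡ 0 → ∃[ q ] Prime q × H′ ≡ H * q
  single-insertion L₋≡0 with divides k H′≡kH ← L₋≡0⇒H∣H′ L₋≡0 = go (factors fk) (factorsPrime fk) H′≡
    where
    instance
      k≢0 : NonZero k
      k≢0 = ∣⇒nonZero (divides H (trans H′≡kH (*-comm k H)))
    fk = factorise k
    H′≡ : H′ ≡ H * product (factors fk)
    H′≡ = trans H′≡kH (trans (*-comm k H) (cong (H *_) (isFactorisation fk)))
    go : ∀ qs → All Prime qs → H′ ≡ H * product qs → ∃[ q ] Prime q × H′ ≡ H * q
    -- An empty list of primes would give `H′ ≡ H`; otherwise inserting the first prime already
    -- reaches `H′`.
    go []       []       H′≡H = contradiction (sym (trans H′≡H (*-identityʳ H))) (<⇒≢ ordered)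
    go (q ∷ qs) (pq ∷ _) H′≡Hqs = q , pq , sym (H*prime≡H′ pq (∣⇒≤
      (divides (product qs) (trans H′≡Hqs (trans (sym (*-assoc H q (product qs))) (*-comm (H * q) (product qs)))))))

  L₋≡0⇒IsMaxMin : L₋ H H′ ≡ 0 → IsMaxMin H H′ (d H)
  L₋≡0⇒IsMaxMin L₋≡0 = record
    { attained = ascend H H′ (L₋≡0⇒H∣H′ L₋≡0)
    ; maximal  = λ γ _ → minDivisors≤source γ
    }

  -- Transitions with one deletion

  UniqueDeletion : ℕ → Set
  UniqueDeletion p = Prime p × ν p H ≡ suc (ν p H′) × (∀ q → Prime q → ν q H′ < ν q H → q ≡ p)

  L₋≡1⇒UniqueDeletion : L₋ H H′ ≡ 1 → ∃[ p ] UniqueDeletion p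
  L₋≡1⇒UniqueDeletion L₋≡1 with p , p∈ , excess≡1 , unique ← sum≡1⇒unique excess primes L₋≡1 =
    p , proj₂ (∈-filter⁻ prime? {xs = upTo (suc (H ⊔ H′))} p∈) ,
    trans (sym (m∸n+n≡m {ν p H} {ν p H′} (<⇒≤ (m∸n≢0⇒n<m λ excess≡0 → contradiction (trans (sym excess≡1) excess≡0) λ ()))))
          (cong (_+ ν p H′) excess≡1) ,
    λ q pq ν< → unique (excess∈primes pq ν<) (m>n⇒m∸n≢0 ν<)

  module _ {p} (deletion-p : UniqueDeletion p) where

    private
      pp     = proj₁ deletion-p
      νpH    = proj₁ (proj₂ deletion-p)
      unique = proj₂ (proj₂ deletion-p)

    admissible-first-step : Step H′ H w → w ≤ H′ → H ≡ w * p
    admissible-first-step {w} s w≤H′ = go (Step.exponentStep s)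
      where
      instance
        w≢0 : NonZero w
        w≢0 = >-nonZero (Step.target-positive s)
      go : ExponentStep H′ H w → H ≡ w * p
      go (insertion q pq _ νw same) = contradiction ν≤ (<⇒≱ (≤-reflexive (sym νpH)))
        where
        ν≤ : ν p H ≤ ν p H′
        ν≤ = ν-mono-∣ p (divides q (trans
          (sym (H*prime≡H′ pq (subst (_≤ H′) (*-prime-unique H w pq νw same) w≤H′))) (*-comm H q)))
      -- Only `p` may be deleted, and the deletion read backwards inserts `p` into `w`.
      go (deletion q pq ν< νw same) with refl ← unique q pq ν< =
        *-prime-unique w H pp (sym νw) (λ r pr r≢p → sym (same r pr r≢p))

    -- The quotient `w` of `H` by `p`

    module _ (H≡w*p : H ≡ w * p) where

      private instance
        w≢0 : NonZero w
        w≢0 = ∣⇒nonZero {H} (divides p (trans H≡w*p (*-comm w p)))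

      ν-deleted : ν p H ≡ suc (ν p w)
      ν-deleted = trans (cong (ν p) H≡w*p) (ν-*-self w pp)

      ν-kept : q ≢ p → ν q w ≡ ν q H
      ν-kept {q} q≢p = sym (trans (cong (ν q) H≡w*p) (ν-*-other w pp q≢p))

      delete : Step H′ H w
      delete = record
        { source-positive = >-nonZero⁻¹ H
        ; target-positive = >-nonZero⁻¹ w
        ; exponentStep    = deletion p pp (≤-reflexive (sym νpH)) (sym ν-deleted) (λ _ _ → ν-kept)
        }

      -- After the deletion the exponents at `p` agree, and no other prime has a larger exponent in
      -- `H` than in `H′`.
      deleted∣H′ : w ∣ H′
      deleted∣H′ = ν-≤⇒∣ w H′ ν≤
        where
        ν≤ : ∀ q → Prime q → ν q w ≤ ν q H′
        ν≤ q pq with q ≟ p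
        ... | yes refl = ≤-reflexive (suc-injective (trans (sym ν-deleted) νpH))
        ... | no q≢p   = subst (_≤ ν q H′) (sym (ν-kept q≢p)) (≮⇒≥ (q≢p ∘ unique q pq))

      deletion-IsMaxMin : IsMaxMin H H′ (d w)
      deletion-IsMaxMin = record { attained = attained ; maximal = maximal }
        where
        attained : ∃[ γ ] Admissible {H} {H′} γ × minDivisors γ ≡ d w
        attained with γ , adm , min≡ ← ascend w H′ deleted∣H′ =
          delete ◅ γ , <⇒≤ ordered ∷ adm ,
          trans (cong (d H ⊓_) min≡)
            (m≥n⇒m⊓n≡n (<⇒≤ (subst (λ n → d w < d n) (sym H≡w*p) (d-<-*-prime w pp))))

        -- H and H′ are generalised to z and T so that matching on ε is possible.
        through : ∀ {z T} (γ : Geodesic z T) → z < T → Admissible γ →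
                  (∀ {v} → Step T z v → v ≤ T → v ≡ w) → minDivisors γ ≤ d w
        through ε z<z _ _ = contradiction z<z (<-irrefl refl)
        through {z} (s ◅ γ) _ (_ ∷ adm) first with refl ← first s (source-admissible γ adm) =
          ≤-trans (m⊓n≤n (d z) _) (minDivisors≤source γ)

        maximal : (γ : Geodesic H H′) → Admissible γ → minDivisors γ ≤ d w
        maximal γ adm = through γ ordered adm λ {v} s v≤H′ →
          -- Both `v * p` and `w * p` equal `H`, so every admissible first step lands on `w`.
          *-cancelʳ-≡ v w p {{prime⇒nonZero pp}} (trans (sym (admissible-first-step s v≤H′)) H≡w*p)

      d-deleted : ∃[ c ] d w ≡ ν p H * c × d H ≡ suc (ν p H) * c
      d-deleted with c , _ , dw≡ , dwp≡ ← d-*-prime w pp =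
        c , trans dw≡ (cong (_* c) (sym ν-deleted)) ,
        trans (cong d H≡w*p) (trans dwp≡ (cong (λ a → suc a * c) (sym ν-deleted)))

-- Comparison of fractions

/-cross : ∀ m n k l .{{_ : NonZero n}} .{{_ : NonZero l}} → m * l ≡ k * n → (+ m) / n ≡ (+ k) / l
/-cross m (suc n) k (suc l) eq = ℚ.fromℚᵘ-cong {mkℚᵘ (+ m) n} {mkℚᵘ (+ k) l}
  (*≡* (trans (sym (ℤ.pos-* m (suc l))) (trans (cong +_ eq) (ℤ.pos-* k (suc n)))))

-- Cross-multiplied in unnormalised form, where `mkℚᵘ (+ a) a` has denominator `suc a`, the claim is
-- `1 + a ≤ a + a`.
½≤a/1+a : ∀ a → 1 ≤ a → (+ a) / suc a ≥ ½
½≤a/1+a a 1≤a = ℚ.toℚᵘ-cancel-≤ (ℚᵘ.≤-respʳ-≃ (ℚᵘ.≃-sym (ℚ.toℚᵘ-fromℚᵘ (mkℚᵘ (+ a) a)))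
  (*≤* (subst₂ ℤ._≤_ (ℤ.pos-* 1 (suc a)) (ℤ.pos-* a 2) (ℤ.+≤+ 1+a≤a*2))))
  where
  1+a≤a*2 : 1 * suc a ≤ a * 2
  1+a≤a*2 = subst₂ _≤_ (sym (*-identityˡ (suc a))) (trans (cong (_+_ a) (sym (+-identityʳ a))) (*-comm 2 a)) (+-monoˡ-≤ a 1≤a)

theorem5p1 : ∀ (H H′ : ℕ) → .{{_ : NonZero H}} → ConsecutiveHC H H′ →
    (L₋ H H′ ≡ 0 →
    (∃[ q ] Prime q × H′ ≡ H * q) × βᵍᵉᵒ[ H , H′ ]≡ 1ℚ)
    ×
    (L₋ H H′ ≡ 1 →
    ∃[ p ] (Prime p × ν p H′ < ν p H)
    × (∀ q → Prime q → ν q H′ < ν q H → q ≡ p)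
    × ν p H ≡ suc (ν p H′)
    × βᵍᵉᵒ[ H , H′ ]≡ ((+ ν p H) / suc (ν p H))
    × ((+ ν p H) / suc (ν p H)) ≥ ½)
theorem5p1 H H′ consecutive = insertion-case , deletion-case
  where
  instance _ = d-nonZero H
  insertion-case : _
  insertion-case L₋≡0 = single-insertion consecutive L₋≡0 ,
    (d H , L₋≡0⇒IsMaxMin consecutive L₋≡0 , /-cross 1 1 (d H) (d H) (*-comm 1 (d H)))

  deletion-case : _
  deletion-case L₋≡1 with p , del@(pp , νpH , unique) ← L₋≡1⇒UniqueDeletion consecutive L₋≡1
    -- The exponent of `p` in `H` is a successor, so `p` divides `H`, and `w` is the quotient.
    with divides w H≡w*p ← ν≢0⇒∣ p H (λ ν≡0 → contradiction (trans (sym ν≡0) νpH) λ ())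
    with c , dw≡ , dH≡ ← d-deleted consecutive del {w} H≡w*p =
      p , (pp , ≤-reflexive (sym νpH)) , unique , νpH ,
      (d w , deletion-IsMaxMin consecutive del {w} H≡w*p ,
       -- Both cross products equal `a * c * suc a`, as `d w` is `a * c` and `d H` is `suc a * c`.
       /-cross a (suc a) (d w) (d H)
         (trans (cong (a *_) dH≡) (trans (cong (a *_) (*-comm (suc a) c))
           (trans (sym (*-assoc a c (suc a))) (cong (_* suc a) (sym dw≡)))))) ,
      ½≤a/1+a a (subst (1 ≤_) (sym νpH) (s≤s z≤n))
    where a = ν p H
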